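{- Let $\Delta,k$ be integers with $k\ge 1$, $\Delta\ge k+2$ and $\Delta$ odd. Then there is a gadget, i.e. a realizable instance of $\Delta$-$k$-DiTTR (so that $D_{u,v}\ge\hat d(u,v)+k$ for all $u,v$), that enforces $\lambda(v_1,v_2)=\lambda(v_2,v_1)$ for some pair of adjacent vertices $(v_1,v_2)$.
   Context: All graphs are finite. A $\Delta$-periodic labeling of a directed graph $G=(V,E)$ is a map $\lambda:E\to\{0,1,\dots,\Delta-1\}$; edge $e$ is then active exactly at the times $\lambda(e)+i\Delta$, $i\in\mathbb{N}_0$. A temporal $s$-$z$-path is a sequence $(v_{i-1},v_i,t_i)_{i=1}^{\ell}$ with $v_0=s$, $v_\ell=z$, pairwise distinct vertices $v_0,\dots,v_\ell$, $(v_{i-1},v_i)\in E$ active at time $t_i$ for every $i$, and $t_1<t_2<\dots<t_\ell$ (strictly increasing). Its duration is $t_\ell+1-t_1$. A fastest temporal path is one of minimum duration. $\hat d(u,v)$ is the distance from $u$ to $v$ in the static graph $G$ (all edges have unit length). A bidirected tree is the directed graph obtained from an undirected tree by replacing each edge $\{u,v\}$ by the two directed edges $(u,v),(v,u)$ (which may get different labels). For integers $\Delta\ge1,k\ge0$, an instance of $\Delta$-$k$-DiTTR consists of a bidirected tree $G=(V,E)$ and a matrix $D$ indexed by $V\times V$ with entries positive integers or $\infty$ (no restriction) such that $D_{u,v}\ge\hat d(u,v)+k$ for all $u,v$. A valid labeling is a $\Delta$-periodic labeling $\lambda$ of $E$ such that, for all $u,v\in V$, the duration of a fastest temporal path from $u$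 to $v$ is at most $D_{u,v}$; the instance is realizable if a valid labeling exists. Diagonal entries of $D$ play no role; all conditions on $D$ are for distinct vertices. An instance enforces $\lambda(v_1,v_2)=\lambda(v_2,v_1)$ if this equality holds for every valid labeling $\lambda$. -}

module Defs where

open import Data.Bool using (Bool; false; T)
open import Data.Fin as Fin using (Fin; zero; suc; toℕ; fromℕ; inject₁)
open import Data.Nat using (ℕ; zero; suc; _+_; _*_; _∸_; _≤_; _<_)
open import Data.Product using (Σ; ∃; _×_)
open import Function.Definitions using (Injective)
open import Relation.Binary.Construct.Add.Supremum.NonStrict _≤_ using (_≤⁺_)
open import Relation.Binary.PropositionalEquality using (_≡_; _≢_; subst)
open import Relation.Nullary using (¬_)
open import Relation.Nullary.Construct.Add.Supremum using (_⁺; [_])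

record DiGraph : Set where
  field
    order : ℕ
    edge? : Fin order → Fin order → Bool

  Vertex : Set
  Vertex = Fin order

  Edge : Vertex → Vertex → Set
  Edge u v = T (edge? u v)

record SimpleGraph : Set where
  field
    order     : ℕ
    adj?      : Fin order → Fin order → Bool
    symmetric : ∀ u v → adj? u v ≡ adj? v u
    loopless  : ∀ u → adj? u u ≡ false

-- adj? is symmetric, so each undirected edge {u,v} gives both (u,v) and (v,u).
bidirected : SimpleGraph → DiGraph
bidirected G = record { order = order ; edge? = adj? }
  where open SimpleGraph G

reverse : (G : SimpleGraph) {u v : DiGraph.Vertex (bidirected G)} →
          DiGraph.Edge (bidirected G) u v → DiGraph.Edge (bidirected G) v u
reverse G {u} {v} = subst T (SimpleGraph.symmetric G u v)

module _ (G : DiGraph) where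
  open DiGraph G

  record Path (s z : Vertex) : Set where
    field
      len      : ℕ
      vertex   : Fin (suc len) → Vertex
      starts   : vertex zero ≡ s
      ends     : vertex (fromℕ len) ≡ z
      distinct : Injective _≡_ _≡_ vertex
      edge     : (i : Fin len) → Edge (vertex (inject₁ i)) (vertex (suc i))

  IsDistance : Vertex → Vertex → ℕ → Set
  IsDistance u v d = (Σ (Path u v) λ P → Path.len P ≡ d)
                   × ((P : Path u v) → d ≤ Path.len P)

record Cycle (G : SimpleGraph) : Set where
  open DiGraph (bidirected G)
  field
    m        : ℕ
    vertex   : Fin (3 + m) → Vertex
    distinct : Injective _≡_ _≡_ vertex
    edge     : (i : Fin (2 + m)) → Edge (vertex (inject₁ i)) (vertex (suc i))
    closing  : Edge (vertex (fromℕ (2 + m))) (vertex zero)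

record IsTree (G : SimpleGraph) : Set where
  open DiGraph (bidirected G)
  field
    nonempty  : 1 ≤ order
    connected : (u v : Vertex) → Path (bidirected G) u v
    acyclic   : ¬ Cycle G

Labeling : ℕ → DiGraph → Set
Labeling Δ G = (u v : Vertex) → Edge u v → Fin Δ
  where open DiGraph G

-- t_ℓ + 1 - t_1 for the times t_1, …, t_ℓ.  The value for ℓ = 0 is a
-- convention that is never used: paths between distinct vertices have ℓ ≥ 1.
span : (ℓ : ℕ) → (Fin ℓ → ℕ) → ℕ
span zero    t = 0
span (suc m) t = t (fromℕ m) + 1 ∸ t zero

module _ {Δ : ℕ} (G : DiGraph) (lab : Labeling Δ G) where
  open DiGraph G

  ActiveAt : {u v : Vertex} → Edge u v → ℕ → Set
  ActiveAt {u} {v} e t = ∃ λ i → t ≡ toℕ (lab u v e) + i * Δ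

  record TemporalPath (s z : Vertex) : Set where
    field
      path : Path G s z
    open Path path public
    field
      time       : Fin len → ℕ
      active     : (i : Fin len) → ActiveAt (edge i) (time i)
      increasing : (i j : Fin len) → i Fin.< j → time i < time j

    duration : ℕ
    duration = span len time

  IsFastest : {s z : Vertex} → TemporalPath s z → Set
  IsFastest {s} {z} P =
    (Q : TemporalPath s z) → TemporalPath.duration P ≤ TemporalPath.duration Q

-- The period Δ does not constrain the tree or D; it is the period of the
-- labelings of the instance.  D takes values in ℕ ⁺ = ℕ ∪ {∞}.  Distances
-- exist (and are unique) because a tree is connected, so `bounded` says
-- d̂(u,v) + k ≤ D u v for all u ≢ v.
record DiTTR (Δ k : ℕ) : Set where
  field
    tree   : SimpleGraph
    isTree : IsTree tree

  graph : DiGraph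
  graph = bidirected tree

  open DiGraph graph public

  field
    D        : Vertex → Vertex → ℕ ⁺
    positive : (u v : Vertex) → u ≢ v → [ 1 ] ≤⁺ D u v
    bounded  : (u v : Vertex) → u ≢ v →
               (d : ℕ) → IsDistance graph u v d → [ d + k ] ≤⁺ D u v

module _ {Δ k : ℕ} (I : DiTTR Δ k) where
  open DiTTR I

  -- Entries equal to ∞ impose no restriction.
  Valid : Labeling Δ graph → Set
  Valid lab = (u v : Vertex) → u ≢ v → (d : ℕ) → D u v ≡ [ d ] →
    Σ (TemporalPath graph lab u v) λ P →
      IsFastest graph lab P × TemporalPath.duration P ≤ d

  Realizable : Set
  Realizable = ∃ Valid

  EnforcesEqual : {v₁ v₂ : Vertex} → Edge v₁ v₂ → Set
  EnforcesEqual {v₁} {v₂} e = (lab : Labeling Δ graph) → Valid lab →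
    lab v₁ v₂ e ≡ lab v₂ v₁ (reverse tree e)

{-# OPTIONS --safe #-}
module Submission where

-- With K = Δ − 2, take combs: a spine c₀ … cₙ with a tooth at every spine vertex, where
-- D = distance + K between teeth and D = ∞ elsewhere.  So a path between teeth may idle for at
-- most K steps in total; in particular it never uses two consecutive edges with equal labels.
--
-- Suppose that some valid labeling of a comb gives the last tooth an outgoing label a and an
-- incoming label b with a ≢ b.  Then the comb with one tooth more is realizable: label the new
-- spine edge by a, b and the new tooth by a − 1, b + 1, so that no new path idles more than an
-- old one, except that the old and the new tooth need a ≢ b.
--
-- Long combs are not realizable.  Let W and V be the idle times accumulated on paths towards and
-- from the end of the spine; both are at most K and neither decreases along the spine.  While
-- they are constant, a − b drops by 2 per spine edge, so it takes all values modulo the odd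
-- number Δ; but at a − b ≡ − min(W, V) no labels of the tooth there are possible.
--
-- Hence some comb is realizable while every valid labeling of it has a = b on its last tooth.

open import Defs
open import Data.Bool using (Bool; true; false; T; _∧_; if_then_else_)
open import Data.Bool.Properties using (T?; T-irrelevant)
open import Data.Empty using (⊥-elim)
open import Data.Fin as Fin using (Fin; zero; suc; toℕ; fromℕ; inject₁)
open import Data.Fin.Properties using (_≟_; any?; all?; toℕ-injective; toℕ<n; toℕ-fromℕ<; toℕ-inject₁; suc-injective)
open import Data.Fin.Relation.Unary.Top using (View; view; ‵fromℕ; ‵inject₁)
open import Data.Nat using (ℕ; zero; suc; _+_; _*_; _∸_; _⊓_; _⊔_; _≤_; _<_; z≤n; s≤s; _≤?_; _<?_; _%_; _/_)
open import Data.Nat.DivMod using (m%n<n; m%n≤m; m%n%n≡m%n; m<n⇒m%n≡m; m≡m%n+[m/n]*n; [m+kn]%n≡m%n; %-distribˡ-+; _mod_)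
open import Data.Nat.Divisibility using (_∣_; m%n≡0⇒n∣m)
open import Data.Nat.Properties hiding (_≟_; suc-injective)
open import Data.Nat.Tactic.RingSolver using (solve-∀)
open import Data.Product using (Σ; ∃; _×_; _,_; proj₁; proj₂)
open import Data.Sum using (inj₁; inj₂)
open import Data.Unit using (tt)
open import Function using (_∘_)
open import Function.Definitions using (Injective)
open import Relation.Binary.Construct.Add.Supremum.NonStrict _≤_ using (_≤⁺_; [_]; _≤⊤⁺)
open import Relation.Binary.PropositionalEquality
open import Relation.Nullary using (¬_; Dec; yes; no; ¬?; _→-dec_; _×-dec_; contradiction)
open import Relation.Nullary.Construct.Add.Supremum using (_⁺; [_]; ⊤⁺)
open import Relation.Nullary.Decidable using (⌊_⌋; toWitness; fromWitness; map′; decidable-stable)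

-- Minima over finite sets and sequences extended at the end

argmin : ∀ {n} (f : Fin (suc n) → ℕ) → ∃ λ i → ∀ j → f i ≤ f j
argmin {zero}  f = zero , λ { zero → ≤-refl }
argmin {suc n} f with argmin (f ∘ suc)
... | i , least with ≤-total (f zero) (f (suc i))
...   | inj₁ p = zero  , λ { zero → ≤-refl ; (suc j) → ≤-trans p (least j) }
...   | inj₂ p = suc i , λ { zero → p ; (suc j) → least j }

⊔-elim : ∀ (P : ℕ → Set) {x y} → P x → P y → P (x ⊔ y)
⊔-elim P {x} {y} px py with ⊔-sel x y
... | inj₁ eq = subst P (sym eq) px
... | inj₂ eq = subst P (sym eq) py

snoc : ∀ {A : Set} {n} → (Fin n → A) → A → Fin (suc n) → A
snoc {n = zero}  f x _       = x
snoc {n = suc n} f x zero    = f zero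
snoc {n = suc n} f x (suc i) = snoc (f ∘ suc) x i

snoc-last : ∀ {A : Set} n (f : Fin n → A) x → snoc f x (fromℕ n) ≡ x
snoc-last zero    f x = refl
snoc-last (suc n) f x = snoc-last n (f ∘ suc) x

snoc-all : ∀ {A : Set} (P : A → Set) {n} {f : Fin n → A} {x} →
           (∀ i → P (f i)) → P x → ∀ i → P (snoc f x i)
snoc-all P {zero}  all last _       = last
snoc-all P {suc n} all last zero    = all zero
snoc-all P {suc n} all last (suc i) = snoc-all P (all ∘ suc) last i

-- With vertices as `f` and times as `g`, which has one entry per consecutive pair of `f`, this
-- lengthens a temporal path by a final edge.
snoc-step : ∀ {A B : Set} (R : A → A → B → Set) n
            {f : Fin (suc n) → A} {x} {g : Fin n → B} {y} →
            (∀ i → R (f (inject₁ i)) (f (suc i)) (g i)) → R (f (fromℕ n)) x y →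
            ∀ i → R (snoc f x (inject₁ i)) (snoc f x (suc i)) (snoc g y i)
snoc-step R zero    steps last zero    = last
snoc-step R (suc n) steps last zero    = steps zero
snoc-step R (suc n) steps last (suc i) = snoc-step R n (steps ∘ suc) last i

snoc-injective : ∀ {A : Set} {n} {f : Fin n → A} {x} → Injective _≡_ _≡_ f →
                 (∀ i → f i ≢ x) → Injective _≡_ _≡_ (snoc f x)
snoc-injective {n = zero}  inj new {zero}  {zero}  _ = refl
snoc-injective {n = suc n} inj new {zero}  {zero}  _ = refl
snoc-injective {n = suc n} {f} inj new {zero} {suc j} eq =
  ⊥-elim (snoc-all (f zero ≢_) (λ i p → contradiction (inj p) λ ()) (new zero) j eq)
snoc-injective {n = suc n} {f} inj new {suc i} {zero} eq =
  ⊥-elim (snoc-all (f zero ≢_) (λ i p → contradiction (inj p) λ ()) (new zero) i (sym eq))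
snoc-injective {n = suc n} inj new {suc i} {suc j} eq =
  cong suc (snoc-injective (suc-injective ∘ inj) (new ∘ suc) eq)

snoc-increasing : ∀ {n} {f : Fin n → ℕ} {x} → (∀ i j → i Fin.< j → f i < f j) →
                  (∀ i → f i < x) → ∀ i j → i Fin.< j → snoc f x i < snoc f x j
snoc-increasing {zero}  inc new zero    zero    ()
snoc-increasing {suc n} {f} inc new zero (suc j) _ =
  snoc-all (f zero <_) (λ i → inc zero (suc i) (s≤s z≤n)) (new zero) j
snoc-increasing {suc n} inc new (suc i) (suc j) (s≤s i<j) =
  snoc-increasing (λ i j p → inc (suc i) (suc j) (s≤s p)) (new ∘ suc) i j i<j

-- Trees grown leaf by leaf

-- In `grow τ e` the new leaf becomes vertex `zero`, attached to the old vertex `e`, and the old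
-- vertices shift by `suc`. The index counts edges.
data Tree : ℕ → Set where
  single : Tree 0
  grow   : ∀ {n} → Tree n → Fin (suc n) → Tree (suc n)

adj : ∀ {n} → Tree n → Fin (suc n) → Fin (suc n) → Bool
adj single     _       _       = false
adj (grow τ e) zero    zero    = false
adj (grow τ e) zero    (suc v) = ⌊ v ≟ e ⌋
adj (grow τ e) (suc u) zero    = ⌊ u ≟ e ⌋
adj (grow τ e) (suc u) (suc v) = adj τ u v

adj-sym : ∀ {n} (τ : Tree n) u v → adj τ u v ≡ adj τ v u
adj-sym single     _       _       = refl
adj-sym (grow τ e) zero    zero    = refl
adj-sym (grow τ e) zero    (suc v) = refl
adj-sym (grow τ e) (suc u) zero    = refl
adj-sym (grow τ e) (suc u) (suc v) = adj-sym τ u v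

adj-irrefl : ∀ {n} (τ : Tree n) u → adj τ u u ≡ false
adj-irrefl single     _       = refl
adj-irrefl (grow τ e) zero    = refl
adj-irrefl (grow τ e) (suc u) = adj-irrefl τ u

treeGraph : ∀ {n} → Tree n → SimpleGraph
treeGraph {n} τ = record
  { order = suc n ; adj? = adj τ ; symmetric = adj-sym τ ; loopless = adj-irrefl τ }

diGraph : ∀ {n} → Tree n → DiGraph
diGraph τ = bidirected (treeGraph τ)

hop : ∀ {n} → Tree n → Fin (suc n) → Fin (suc n) → ℕ
hop single     _       _       = 0
hop (grow τ e) zero    zero    = 0
hop (grow τ e) zero    (suc v) = suc (hop τ e v)
hop (grow τ e) (suc u) zero    = suc (hop τ u e)
hop (grow τ e) (suc u) (suc v) = hop τ u v

hop-self : ∀ {n} (τ : Tree n) u → hop τ u u ≡ 0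
hop-self single     _       = refl
hop-self (grow τ e) zero    = refl
hop-self (grow τ e) (suc u) = hop-self τ u

hop-positive : ∀ {n} (τ : Tree n) u v → u ≢ v → 1 ≤ hop τ u v
hop-positive single     zero    zero    u≢v = ⊥-elim (u≢v refl)
hop-positive (grow τ e) zero    zero    u≢v = ⊥-elim (u≢v refl)
hop-positive (grow τ e) zero    (suc v) u≢v = s≤s z≤n
hop-positive (grow τ e) (suc u) zero    u≢v = s≤s z≤n
hop-positive (grow τ e) (suc u) (suc v) u≢v = hop-positive τ u v (u≢v ∘ cong suc)

-- Older vertices have larger numbers, so the only larger neighbour of a vertex is the one it was
-- attached to when it was added.
upper-neighbour-unique : ∀ {n} (τ : Tree n) {u v w} → T (adj τ u v) → T (adj τ u w) →
                         u Fin.< v → u Fin.< w → v ≡ w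
upper-neighbour-unique (grow τ e) {zero} {suc v} {suc w} uv uw _ _ =
  cong suc (trans (toWitness uv) (sym (toWitness uw)))
upper-neighbour-unique (grow τ e) {suc u} {suc v} {suc w} uv uw (s≤s u<v) (s≤s u<w) =
  cong suc (upper-neighbour-unique τ uv uw u<v u<w)

module _ {G : SimpleGraph} (C : Cycle G) where
  open Cycle C
  open DiGraph (bidirected G)

  cycle-neighbours : ∀ i → ∃ λ j → ∃ λ j′ → i ≢ j × i ≢ j′ × j ≢ j′ ×
                     Edge (vertex i) (vertex j) × Edge (vertex i) (vertex j′)
  cycle-neighbours zero =
    suc zero , fromℕ (2 + m) , (λ ()) , (λ ()) , (λ ()) , edge zero , reverse G closing
  cycle-neighbours (suc i) = next (suc i) i refl (view (suc i))
    where
    -- The position is generalised to `k`, so that the view can single out the last position while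
    -- the predecessor `i` stays at hand.
    next : ∀ k (i : Fin (2 + m)) → k ≡ suc i → View k →
           ∃ λ j → ∃ λ j′ → k ≢ j × k ≢ j′ × j ≢ j′ ×
           Edge (vertex k) (vertex j) × Edge (vertex k) (vertex j′)
    next .(suc (fromℕ (1 + m))) i eq ‵fromℕ with suc-injective eq
    ... | refl =
      inject₁ (fromℕ (1 + m)) , zero
      , (λ p → <⇒≢ (n<1+n _) (sym (trans (cong toℕ p) (toℕ-inject₁ (fromℕ (1 + m))))))
      , (λ ()) , (λ ()) , reverse G (edge i) , closing
    next .(inject₁ k) i eq (‵inject₁ k) =
      inject₁ i , suc k
      , (λ p → <⇒≢ (n<1+n _) (trans (sym (toℕ-inject₁ i)) (trans (cong toℕ (sym p)) (cong toℕ eq))))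
      , (λ p → <⇒≢ (n<1+n _) (trans (sym (toℕ-inject₁ k)) (cong toℕ p)))
      , (λ p → <⇒≢ (≤-trans (n<1+n _) (n≤1+n _))
                 (trans (trans (sym (toℕ-inject₁ i)) (cong toℕ p))
                   (cong suc (trans (sym (toℕ-inject₁ k)) (cong toℕ eq)))))
      , subst (λ x → Edge (vertex x) (vertex (inject₁ i))) (sym eq) (reverse G (edge i))
      , edge k

-- The smallest vertex of a cycle would have two larger neighbours.
acyclic : ∀ {n} (τ : Tree n) → ¬ Cycle (treeGraph τ)
acyclic τ C with argmin (toℕ ∘ Cycle.vertex C)
... | i , least with cycle-neighbours C i
... | j , j′ , i≢j , i≢j′ , j≢j′ , ij , ij′ =
  j≢j′ (distinct (upper-neighbour-unique τ ij ij′ (above i≢j) (above i≢j′)))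
  where
  open Cycle C
  above : ∀ {j} → i ≢ j → vertex i Fin.< vertex j
  above {j} i≢j = ≤∧≢⇒< (least j) (i≢j ∘ distinct ∘ toℕ-injective)

-- Waiting times modulo the period

module Periodic (m : ℕ) where

  Δ : ℕ
  Δ = suc m

  infix 4 _≈_

  -- Wrapped in a record so that `x` and `y` can be inferred from the type.
  record _≈_ (x y : ℕ) : Set where
    constructor congruent
    field residues : x % Δ ≡ y % Δ
  open _≈_

  ≡⇒≈ : ∀ {x y} → x ≡ y → x ≈ y
  ≡⇒≈ = congruent ∘ cong (_% Δ)

  ≈-refl : ∀ {x} → x ≈ x
  ≈-refl = congruent refl

  ≈-sym : ∀ {x y} → x ≈ y → y ≈ x
  ≈-sym p = congruent (sym (residues p))

  ≈-trans : ∀ {x y z} → x ≈ y → y ≈ z → x ≈ z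
  ≈-trans p q = congruent (trans (residues p) (residues q))

  ≈-+ : ∀ {x y u v} → x ≈ y → u ≈ v → x + u ≈ y + v
  ≈-+ {x} {y} {u} {v} p q = congruent (trans (%-distribˡ-+ x u Δ)
    (trans (cong₂ (λ a b → (a + b) % Δ) (residues p) (residues q)) (sym (%-distribˡ-+ y v Δ))))

  +-multiple : ∀ x k → x + k * Δ ≈ x
  +-multiple x k = congruent ([m+kn]%n≡m%n x k Δ)

  %-≈ : ∀ x → x % Δ ≈ x
  %-≈ x = congruent (m%n%n≡m%n x Δ)

  -- Adding `z * m` subtracts `z`, because `z + z * m` is a multiple of `Δ`.
  ≈-cancelʳ : ∀ {x y} z → x + z ≈ y + z → x ≈ y
  ≈-cancelʳ {x} {y} z p =
    ≈-trans (≈-sym (undo x)) (≈-trans (≈-+ p (≈-refl {z * m})) (undo y))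
    where
    ring : ∀ x z m → x + z + z * m ≡ x + z * suc m
    ring = solve-∀
    undo : ∀ x → x + z + z * m ≈ x
    undo x = ≈-trans (≡⇒≈ (ring x z m)) (+-multiple x z)

  ≈-cancelˡ : ∀ {x y} z → z + x ≈ z + y → x ≈ y
  ≈-cancelˡ {x} {y} z p =
    ≈-cancelʳ z (≈-trans (≡⇒≈ (+-comm x z)) (≈-trans p (≡⇒≈ (+-comm z y))))

  ≈⇒≡ : ∀ {x y} → x < Δ → y < Δ → x ≈ y → x ≡ y
  ≈⇒≡ x<Δ y<Δ p = trans (sym (m<n⇒m%n≡m x<Δ)) (trans (residues p) (m<n⇒m%n≡m y<Δ))

  -- The number of idle steps from r to the next time congruent to l: r * m stands for −r.
  wait : ℕ → ℕ → ℕ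
  wait l r = (l + r * m) % Δ

  wait-hits : ∀ l r → r + wait l r ≈ l
  wait-hits l r = ≈-trans (≈-+ (≈-refl {r}) (%-≈ (l + r * m)))
    (≈-trans (≡⇒≈ (ring l r m)) (+-multiple l r))
    where
    ring : ∀ l r m → r + (l + r * m) ≡ l + r * suc m
    ring = solve-∀

  wait-≤ : ∀ l r → wait l r ≤ m
  wait-≤ l r = ≤-pred (m%n<n (l + r * m) Δ)

  wait-unique : ∀ {l r} d → r + d ≈ l → wait l r ≡ d % Δ
  wait-unique {l} {r} d p = residues (≈-trans (≈-+ (≈-sym p) (≈-refl {r * m}))
    (≈-trans (≡⇒≈ (ring r d m)) (+-multiple d r)))
    where
    ring : ∀ r d m → r + d + r * m ≡ d + r * suc m
    ring = solve-∀

  wait-zero : ∀ {l r} → r ≈ l → wait l r ≡ 0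
  wait-zero {l} {r} p = wait-unique {l} {r} 0 (≈-trans (≡⇒≈ (+-identityʳ r)) p)

  wait-cong : ∀ l {r r′} → r ≈ r′ → wait l r ≡ wait l r′
  wait-cong l {r} {r′} p = trans
    (wait-unique {l} {r} (wait l r′) (≈-trans (≈-+ p ≈-refl) (wait-hits l r′)))
    (residues (%-≈ (l + r′ * m)))

  wait-least : ∀ l {r t} → r ≤ t → t ≈ l → r + wait l r ≤ t
  wait-least l {r} {t} r≤t p = begin
    r + wait l r
      ≡⟨ cong (r +_) (wait-unique {l} {r} (t ∸ r) (≈-trans (≡⇒≈ (m+[n∸m]≡n r≤t)) p)) ⟩
    r + (t ∸ r) % Δ     ≤⟨ +-monoʳ-≤ r (m%n≤m (t ∸ r) Δ) ⟩
    r + (t ∸ r)         ≡⟨ m+[n∸m]≡n r≤t ⟩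
    t                   ∎
    where open ≤-Reasoning

  -- The arrival time over an edge with label l when waiting for it from time r on.
  next : ℕ → ℕ → ℕ
  next l r = suc (r + wait l r)

  next-least : ∀ l {r t} → r ≤ t → t ≈ l → next l r ≤ suc t
  next-least l r≤t p = s≤s (wait-least l r≤t p)

  next-> : ∀ l r → r < next l r
  next-> l r = s≤s (m≤m+n r _)

  next-now : ∀ l {r} → r ≈ l → next l r ≡ suc r
  next-now l {r} p = cong suc (trans (cong (r +_) (wait-zero p)) (+-identityʳ r))

  next-shift : ∀ l r k → next l (r + k * Δ) ≡ next l r + k * Δ
  next-shift l r k = cong suc (trans (cong (r + k * Δ +_) (wait-cong l (+-multiple r k)))
    (ring r (k * Δ) (wait l r)))
    where
    ring : ∀ r k w → r + k + w ≡ r + w + k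
    ring = solve-∀

  -- The idle time at a vertex entered over label `l` and left over label `l′`. It is 0 if
  -- `l′ ≈ suc l` and takes its maximum `m` if the labels are equal.
  gap : ℕ → ℕ → ℕ
  gap l l′ = wait l′ (suc l)

  gap-hits : ∀ l l′ → suc l + gap l l′ ≈ l′
  gap-hits l l′ = wait-hits l′ (suc l)

  -- After an edge labelled `l` the time is congruent to `suc l`, whatever `r` was. Hence idle times
  -- along a path depend on its labels alone, except for the first wait.
  wait-next : ∀ l l′ r → wait l′ (next l r) ≡ gap l l′
  wait-next l l′ r = wait-cong l′ (≈-+ (≈-refl {1}) (wait-hits l r))

  next-next : ∀ l l′ r → next l′ (next l r) ≡ suc (next l r + gap l l′)
  next-next l l′ r = cong (λ w → suc (next l r + w)) (wait-next l l′ r)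

  -- Labelings as data and earliest arrival times

  -- In L ▷⟨ a ∣ b ⟩, a labels the edge out of the new leaf and b the edge into it.
  data Lab : ∀ {n} → Tree n → Set where
    ∅        : Lab single
    _▷⟨_∣_⟩ : ∀ {n} {τ : Tree n} {e} → Lab τ → Fin Δ → Fin Δ → Lab (grow τ e)

  infixl 5 _▷⟨_∣_⟩

  -- Labelings as inductive data allow an exhaustive search by recursion on the tree, without
  -- function extensionality.
  anyLab? : ∀ {n} (τ : Tree n) {P : Lab τ → Set} → (∀ L → Dec (P L)) → Dec (∃ P)
  anyLab? single P? = map′ (∅ ,_) (λ { (∅ , p) → p }) (P? ∅)
  anyLab? (grow τ e) P? = map′
    (λ { (L , a , b , p) → (L ▷⟨ a ∣ b ⟩) , p })
    (λ { ((L ▷⟨ a ∣ b ⟩) , p) → L , a , b , p })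
    (anyLab? τ λ L → any? λ a → any? λ b → P? (L ▷⟨ a ∣ b ⟩))

  -- Values at non-adjacent pairs are arbitrary; `toLabeling` passes on only those at edges.
  label : ∀ {n} {τ : Tree n} → Lab τ → Fin (suc n) → Fin (suc n) → Fin Δ
  label ∅               _       _       = zero
  label (L ▷⟨ a ∣ b ⟩) zero    zero    = zero
  label (L ▷⟨ a ∣ b ⟩) zero    (suc v) = a
  label (L ▷⟨ a ∣ b ⟩) (suc u) zero    = b
  label (L ▷⟨ a ∣ b ⟩) (suc u) (suc v) = label L u v

  toLabeling : ∀ {n} {τ : Tree n} → Lab τ → Labeling Δ (diGraph τ)
  toLabeling L u v _ = label L u v

  fromLabeling : ∀ {n} (τ : Tree n) → Labeling Δ (diGraph τ) → Lab τ
  fromLabeling single     lab = ∅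
  fromLabeling (grow τ e) lab = fromLabeling τ (λ u v → lab (suc u) (suc v))
    ▷⟨ lab zero (suc e) (fromWitness {a? = e ≟ e} refl)
     ∣ lab (suc e) zero (fromWitness {a? = e ≟ e} refl) ⟩

  -- A `Labeling` also takes the proof that `u v` is an edge; any two such proofs are equal.
  label-fromLabeling : ∀ {n} (τ : Tree n) (lab : Labeling Δ (diGraph τ)) u v e →
                       lab u v e ≡ label (fromLabeling τ lab) u v
  label-fromLabeling single lab u v ()
  label-fromLabeling (grow τ e) lab zero (suc v) uv with toWitness {a? = v ≟ e} uv
  ... | refl = cong (lab zero (suc e)) (T-irrelevant uv _)
  label-fromLabeling (grow τ e) lab (suc u) zero uv with toWitness {a? = u ≟ e} uv
  ... | refl = cong (lab (suc e) zero) (T-irrelevant uv _)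
  label-fromLabeling (grow τ e) lab (suc u) (suc v) uv =
    label-fromLabeling τ (λ u v → lab (suc u) (suc v)) u v uv

  -- The earliest arrival time at v when ready to leave u at time r.
  arr : ∀ {n} {τ : Tree n} → Lab τ → Fin (suc n) → Fin (suc n) → ℕ → ℕ
  arr ∅ _ _ r = r
  arr (L ▷⟨ a ∣ b ⟩) zero zero r = r
  arr (_▷⟨_∣_⟩ {e = e} L a b) zero (suc v) r = arr L e v (next (toℕ a) r)
  arr (_▷⟨_∣_⟩ {e = e} L a b) (suc u) zero r = next (toℕ b) (arr L u e r)
  arr (L ▷⟨ a ∣ b ⟩) (suc u) (suc v) r = arr L u v r

  arr-self : ∀ {n} {τ : Tree n} (L : Lab τ) u r → arr L u u r ≡ r
  arr-self ∅               u       r = refl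
  arr-self (L ▷⟨ a ∣ b ⟩) zero    r = refl
  arr-self (L ▷⟨ a ∣ b ⟩) (suc u) r = arr-self L u r

  arr-≥ : ∀ {n} {τ : Tree n} (L : Lab τ) u v r → r ≤ arr L u v r
  arr-≥ ∅ u v r = ≤-refl
  arr-≥ (L ▷⟨ a ∣ b ⟩) zero    zero    r = ≤-refl
  arr-≥ (L ▷⟨ a ∣ b ⟩) zero    (suc v) r = ≤-trans (<⇒≤ (next-> (toℕ a) r)) (arr-≥ L _ v _)
  arr-≥ (L ▷⟨ a ∣ b ⟩) (suc u) zero    r = ≤-trans (arr-≥ L u _ r) (<⇒≤ (next-> (toℕ b) _))
  arr-≥ (L ▷⟨ a ∣ b ⟩) (suc u) (suc v) r = arr-≥ L u v r

  arr-shift : ∀ {n} {τ : Tree n} (L : Lab τ) u v r k →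
              arr L u v (r + k * Δ) ≡ arr L u v r + k * Δ
  arr-shift ∅ u v r k = refl
  arr-shift (L ▷⟨ a ∣ b ⟩) zero zero r k = refl
  arr-shift (L ▷⟨ a ∣ b ⟩) zero (suc v) r k =
    trans (cong (arr L _ v) (next-shift (toℕ a) r k)) (arr-shift L _ v _ k)
  arr-shift (L ▷⟨ a ∣ b ⟩) (suc u) zero r k =
    trans (cong (next (toℕ b)) (arr-shift L u _ r k)) (next-shift (toℕ b) _ k)
  arr-shift (L ▷⟨ a ∣ b ⟩) (suc u) (suc v) r k = arr-shift L u v r k

  -- For an edge leading away from `s` this is an equality, as tree paths are unique. An edge back
  -- towards `s` ends at a vertex that was passed earlier.
  arr-edge : ∀ {n} {τ : Tree n} (L : Lab τ) s {v w} r → T (adj τ v w) →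
             arr L s w r ≤ next (toℕ (label L v w)) (arr L s v r)
  arr-edge (L ▷⟨ a ∣ b ⟩) zero {zero} {suc w} r vw with toWitness vw
  ... | refl = ≤-reflexive (arr-self L w _)
  arr-edge (L ▷⟨ a ∣ b ⟩) zero {suc v} {zero} r vw with toWitness vw
  ... | refl = ≤-trans (<⇒≤ (next-> (toℕ a) r))
    (≤-trans (≤-reflexive (sym (arr-self L v _))) (<⇒≤ (next-> (toℕ b) _)))
  arr-edge (L ▷⟨ a ∣ b ⟩) zero {suc v} {suc w} r vw = arr-edge L _ _ vw
  arr-edge (L ▷⟨ a ∣ b ⟩) (suc s) {zero} {suc w} r vw with toWitness vw
  ... | refl = ≤-trans (<⇒≤ (next-> (toℕ b) _)) (<⇒≤ (next-> (toℕ a) _))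
  arr-edge (L ▷⟨ a ∣ b ⟩) (suc s) {suc v} {zero} r vw with toWitness vw
  ... | refl = ≤-refl
  arr-edge (L ▷⟨ a ∣ b ⟩) (suc s) {suc v} {suc w} r vw = arr-edge L s r vw

  -- Temporal paths compared with earliest arrivals

  active⇒≈ : ∀ {t} (l : Fin Δ) → (∃ λ i → t ≡ toℕ l + i * Δ) → t ≈ toℕ l
  active⇒≈ l (i , refl) = +-multiple (toℕ l) i

  ≈⇒active : ∀ {t} (l : Fin Δ) → t ≈ toℕ l → ∃ λ i → t ≡ toℕ l + i * Δ
  ≈⇒active {t} l p = t / Δ , trans (m≡m%n+[m/n]*n t Δ)
    (cong (_+ t / Δ * Δ) (trans (residues p) (m<n⇒m%n≡m (toℕ<n l))))

  module _ {n} {τ : Tree n} (L : Lab τ) (lab : Labeling Δ (diGraph τ))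
           (agree : ∀ u v e → lab u v e ≡ label L u v) where

    -- Induction along the path with `arr-edge`. The invariant is that the earliest arrival at the
    -- current vertex is no later than the next departure; the increasing times preserve it.
    arr-sequence : ∀ s r len (vertex : Fin (suc (suc len)) → Fin (suc n))
      (edge : ∀ i → T (adj τ (vertex (inject₁ i)) (vertex (suc i)))) (time : Fin (suc len) → ℕ) →
      (∀ i → ActiveAt (diGraph τ) lab (edge i) (time i)) →
      (∀ i j → i Fin.< j → time i < time j) →
      arr L s (vertex zero) r ≤ time zero →
      arr L s (vertex (fromℕ (suc len))) r ≤ suc (time (fromℕ len))
    arr-sequence s r len vertex edge time active inc start with
      ≤-trans (arr-edge L s r (edge zero))
        (next-least (toℕ (label L (vertex zero) (vertex (suc zero)))) start 
          (≈-trans (active⇒≈ _ (active zero))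
          (≡⇒≈ (cong toℕ (agree _ _ (edge zero))))))
    arr-sequence s r zero vertex edge time active inc start | arrived = arrived
    arr-sequence s r (suc len) vertex edge time active inc start | arrived =
      arr-sequence s r len (vertex ∘ suc) (edge ∘ suc) (time ∘ suc) (active ∘ suc)
        (λ i j p → inc (suc i) (suc j) (s≤s p))
        (≤-trans arrived (inc zero (suc zero) (s≤s z≤n)))

    arr-duration : ∀ {u v} → u ≢ v → (P : TemporalPath (diGraph τ) lab u v) →
                   ∃ λ r → arr L u v r ≤ r + TemporalPath.duration P
    arr-duration u≢v record { path = record { len = zero ; starts = refl ; ends = refl } } =
      ⊥-elim (u≢v refl)
    arr-duration u≢v record
      { path = record { len = suc len ; vertex = vertex ; starts = refl ; ends = refl ; edge = edge }
      ; time = time ; active = active ; increasing = inc } =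
      time zero , ≤-trans
        (arr-sequence (vertex zero) (time zero) len vertex edge time active inc
          (≤-reflexive (arr-self L (vertex zero) (time zero))))
        (≤-trans (≤-reflexive (+-comm 1 _)) (m≤n+m∸n _ (time zero)))

  -- A temporal path that attains the earliest arrival. The bounds `after` and `before` keep the
  -- times increasing when an edge is added at either end.
  record Route {n} {τ : Tree n} (L : Lab τ) (u v : Fin (suc n)) (r : ℕ) : Set where
    field
      walk   : TemporalPath (diGraph τ) (toLabeling L) u v
    open TemporalPath walk public
    field
      after  : ∀ i → r ≤ time i
      before : ∀ i → time i < arr L u v r
      hops   : len ≡ hop τ u v

  stay : ∀ {n} {τ : Tree n} (L : Lab τ) u r → hop τ u u ≡ 0 → Route L u u r
  stay L u r eq = record
    { walk = record
      { path = record
        { len = 0 ; vertex = λ _ → u ; starts = refl ; ends = refl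
        ; distinct = λ { {zero} {zero} _ → refl } ; edge = λ () }
      ; time = λ () ; active = λ () ; increasing = λ () }
    ; after = λ () ; before = λ () ; hops = sym eq }

  embed : ∀ {n} {τ : Tree n} {e} {L : Lab τ} {u v r} a b →
          Route L u v r → Route (_▷⟨_∣_⟩ {e = e} L a b) (suc u) (suc v) r
  embed a b R = record
    { walk = record
      { path = record
        { len = len ; vertex = suc ∘ vertex ; starts = cong suc starts ; ends = cong suc ends
        ; distinct = distinct ∘ suc-injective ; edge = edge }
      ; time = time ; active = active ; increasing = increasing }
    ; after = after ; before = before ; hops = hops }
    where open Route R

  prepend : ∀ {n} {τ : Tree n} {e} {L : Lab τ} {v r} a b →
            Route L e v (next (toℕ a) r) → Route (_▷⟨_∣_⟩ {e = e} L a b) zero (suc v) r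
  prepend {e = e} {L} {v} {r} a b R = record
    { walk = record
      { path = record
        { len = suc len ; vertex = vertex′ ; starts = refl ; ends = cong suc ends
        ; distinct = distinct′
        ; edge = λ { zero → fromWitness starts ; (suc i) → edge i } }
      ; time = time′
      ; active = λ { zero → ≈⇒active a (wait-hits (toℕ a) r) ; (suc i) → active i }
      ; increasing = λ { zero (suc j) _ → after j
                       ; (suc i) (suc j) (s≤s p) → increasing i j p } }
    ; after = λ { zero → m≤m+n r _ ; (suc i) → ≤-trans (<⇒≤ (next-> (toℕ a) r)) (after i) }
    ; before = λ { zero → arr-≥ L e v _ ; (suc i) → before i }
    ; hops = cong suc hops }
    where
    open Route R
    vertex′ : Fin (suc (suc len)) → _
    vertex′ zero    = zero
    vertex′ (suc i) = suc (vertex i)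
    distinct′ : Injective _≡_ _≡_ vertex′
    distinct′ {zero}  {zero}  _  = refl
    distinct′ {suc i} {suc j} eq = cong suc (distinct (suc-injective eq))
    time′ : Fin (suc len) → ℕ
    time′ zero    = r + wait (toℕ a) r
    time′ (suc i) = time i

  append : ∀ {n} {τ : Tree n} {e} {L : Lab τ} {u r} a b →
           Route L u e r → Route (_▷⟨_∣_⟩ {e = e} L a b) (suc u) zero r
  append {τ = τ} {e} {L} {u} {r} a b R = record
    { walk = record
      { path = record
        { len = suc len ; vertex = snoc (suc ∘ vertex) zero
        ; starts = cong suc starts ; ends = snoc-last (suc len) (suc ∘ vertex) zero
        ; distinct = snoc-injective (distinct ∘ suc-injective) (λ i ())
        ; edge = proj₁ ∘ steps }
      ; time = snoc time last
      ; active = proj₂ ∘ steps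
      ; increasing = snoc-increasing increasing
          (λ i → ≤-trans (before i) (m≤m+n _ _)) }
    ; after = snoc-all (r ≤_) after (≤-trans (arr-≥ L u e r) (m≤m+n _ _))
    ; before = snoc-all (_< suc last) (λ i → ≤-trans (before i) (≤-trans (m≤m+n _ _) (n≤1+n _))) ≤-refl
    ; hops = cong suc hops }
    where
    open Route R
    L′ : Lab (grow τ e)
    L′ = L ▷⟨ a ∣ b ⟩
    last : ℕ
    last = arr L u e r + wait (toℕ b) (arr L u e r)
    steps : ∀ i → _ × _
    steps = snoc-step
      (λ v w t → T (adj (grow τ e) v w) × ∃ λ k → t ≡ toℕ (label L′ v w) + k * Δ) len
      (λ i → edge i , active i)
      (fromWitness ends , ≈⇒active b (wait-hits (toℕ b) (arr L u e r)))

  route : ∀ {n} {τ : Tree n} (L : Lab τ) u v r → Route L u v r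
  route ∅ zero zero r = stay ∅ zero r refl
  route (L ▷⟨ a ∣ b ⟩) zero zero r = stay (L ▷⟨ a ∣ b ⟩) zero r refl
  route (L ▷⟨ a ∣ b ⟩) zero (suc v) r = prepend a b (route L _ v _)
  route (L ▷⟨ a ∣ b ⟩) (suc u) zero r = append a b (route L u _ r)
  route (L ▷⟨ a ∣ b ⟩) (suc u) (suc v) r = embed a b (route L u v r)

  -- For `u ≢ v` this says that some temporal path from `u` to `v` has duration at most `d`, by
  -- `arr-duration` and `fastest`.
  Within : ∀ {n} {τ : Tree n} → Lab τ → Fin (suc n) → Fin (suc n) → ℕ → Set
  Within L u v d = ∃ λ r → arr L u v r ≤ r + d

  -- Shifting the departure by whole periods shifts the arrival equally. So departures below `Δ`
  -- suffice, which makes `Within` decidable and a fastest path a finite minimum.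
  reduce-departure : ∀ {n} {τ : Tree n} (L : Lab τ) {u v d} r → arr L u v r ≤ r + d →
                     arr L u v (r % Δ) ≤ r % Δ + d
  reduce-departure L {u} {v} {d} r p = +-cancelʳ-≤ (r / Δ * Δ) _ _ (begin
    arr L u v (r % Δ) + r / Δ * Δ  ≡⟨ sym (arr-shift L u v (r % Δ) (r / Δ)) ⟩
    arr L u v (r % Δ + r / Δ * Δ)  ≡⟨ cong (arr L u v) (sym (m≡m%n+[m/n]*n r Δ)) ⟩
    arr L u v r                    ≤⟨ p ⟩
    r + d                          ≡⟨ cong (_+ d) (m≡m%n+[m/n]*n r Δ) ⟩
    r % Δ + r / Δ * Δ + d          ≡⟨ ring (r % Δ) (r / Δ * Δ) d ⟩
    r % Δ + d + r / Δ * Δ          ∎)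
    where
    open ≤-Reasoning
    ring : ∀ x y z → x + y + z ≡ x + z + y
    ring = solve-∀

  within? : ∀ {n} {τ : Tree n} (L : Lab τ) u v d → Dec (Within L u v d)
  within? L u v d = map′ (λ { (r , p) → toℕ r , p }) reduced
    (any? λ (r : Fin Δ) → arr L u v (toℕ r) ≤? toℕ r + d)
    where
    reduced : Within L u v d → ∃ λ (r : Fin Δ) → arr L u v (toℕ r) ≤ toℕ r + d
    reduced (r , p) = r mod Δ , subst (λ x → arr L u v x ≤ x + d)
      (sym (toℕ-fromℕ< (m%n<n r Δ))) (reduce-departure L r p)

  route-duration : ∀ {n} {τ : Tree n} {L : Lab τ} {u v r} (R : Route L u v r) →
                   Route.duration R ≤ arr L u v r ∸ r
  route-duration {r = r} record { walk = record { path = record { len = zero } } } = z≤n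
  route-duration {r = r} record
    { walk = record { path = record { len = suc len } ; time = time }
    ; after = after ; before = before } =
    ∸-mono (≤-trans (≤-reflexive (+-comm _ 1)) (before (fromℕ len))) (after zero)

  fastest : ∀ {n} {τ : Tree n} (L : Lab τ) {u v} → u ≢ v →
            Σ (TemporalPath (diGraph τ) (toLabeling L) u v) λ P →
              IsFastest (diGraph τ) (toLabeling L) P ×
              (∀ {d} → Within L u v d → TemporalPath.duration P ≤ d)
  fastest L {u} {v} u≢v with argmin (λ (r : Fin Δ) → arr L u v (toℕ r) ∸ toℕ r)
  ... | r , least = Route.walk R
      , (λ Q → short (arr-duration L (toLabeling L) (λ _ _ _ → refl) u≢v Q)) , short
    where
    R : Route L u v (toℕ r)
    R = route L u v (toℕ r)
    short : ∀ {d} → Within L u v d → Route.duration R ≤ d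
    short {d} (r′ , p) = begin
      Route.duration R                           ≤⟨ route-duration R ⟩
      arr L u v (toℕ r) ∸ toℕ r                  ≤⟨ least (r′ mod Δ) ⟩
      arr L u v (toℕ (r′ mod Δ)) ∸ toℕ (r′ mod Δ)
        ≡⟨ cong (λ x → arr L u v x ∸ x) (toℕ-fromℕ< (m%n<n r′ Δ)) ⟩
      arr L u v (r′ % Δ) ∸ r′ % Δ                ≤⟨ m≤n+o⇒m∸n≤o _ _ (reduce-departure L r′ p) ⟩
      d                                          ∎
      where open ≤-Reasoning

-- With period 1 every edge is active at all times, so `route` yields a static path with `hop` many
-- edges.
constantLab : ∀ {n} (τ : Tree n) → Periodic.Lab 0 τ
constantLab single     = Periodic.∅
constantLab (grow τ e) = constantLab τ Periodic.▷⟨ zero ∣ zero ⟩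

treePath : ∀ {n} (τ : Tree n) u v → Σ (Path (diGraph τ) u v) λ P → Path.len P ≡ hop τ u v
treePath τ u v = path , hops
  where open Periodic.Route (Periodic.route 0 (constantLab τ) u v 0)

isTree : ∀ {n} (τ : Tree n) → IsTree (treeGraph τ)
isTree τ = record
  { nonempty = s≤s z≤n ; connected = λ u v → proj₁ (treePath τ u v) ; acyclic = acyclic τ }

-- Combs

-- A comb whose last spine vertex, `zero`, still lacks its tooth. Thus `comb (suc n)` is `comb n`
-- with two more leaves, and in `C ▷⟨ a ∣ b ⟩ ▷⟨ p ∣ q ⟩` the new spine edge carries `a` back
-- towards `C` and `b` away from it, while `p` leads out of the new tooth and `q` into it.
spine : ∀ n → Tree (n * 2)
spine zero    = single
spine (suc n) = grow (grow (spine n) zero) (suc zero)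

-- Vertex zero is the newest tooth and suc zero the spine vertex that carries it.
comb : ∀ n → Tree (suc (n * 2))
comb n = grow (spine n) zero

tooth : ∀ n → Fin (2 + n * 2) → Bool
tooth n       zero          = true
tooth n       (suc zero)    = false
tooth (suc n) (suc (suc i)) = tooth n i

module Gadget (K : ℕ) where
  open Periodic (suc K)

  -- The slack `K` is the largest that forbids consecutive equal labels, which cost `suc K` idle
  -- steps. The same matrix serves every `k ≤ K`.
  D : ∀ n → Fin (2 + n * 2) → Fin (2 + n * 2) → ℕ ⁺
  D n u v = if tooth n u ∧ tooth n v then [ hop (comb n) u v + K ] else ⊤⁺

  instanceOf : ∀ {k} → k ≤ K → ℕ → DiTTR Δ k
  instanceOf {k} k≤K n = record
    { tree = treeGraph (comb n) ; isTree = isTree (comb n) ; D = D n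
    ; positive = positive ; bounded = bounded }
    where
    positive : ∀ u v → u ≢ v → [ 1 ] ≤⁺ D n u v
    positive u v u≢v with tooth n u ∧ tooth n v
    ... | true  = [ ≤-trans (hop-positive (comb n) u v u≢v) (m≤m+n _ K) ]
    ... | false = [ 1 ] ≤⊤⁺

    bounded : ∀ u v → u ≢ v → ∀ d → IsDistance (diGraph (comb n)) u v d → [ d + k ] ≤⁺ D n u v
    bounded u v u≢v d (_ , shortest) with tooth n u ∧ tooth n v
    ... | false = [ d + k ] ≤⊤⁺
    -- The distance `d` is at most the length of this path, which is `hop`.
    ... | true with treePath (comb n) u v
    ...   | P , len≡hop = [ +-mono-≤ (subst (d ≤_) len≡hop (shortest P)) k≤K ]

  -- Validity in terms of earliest arrivals, a form that `good?` decides.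
  Good : ∀ n → Lab (comb n) → Set
  Good n L = ∀ u v → T (tooth n u) → T (tooth n v) → u ≢ v →
             Within L u v (hop (comb n) u v + K)

  good? : ∀ n L → Dec (Good n L)
  good? n L = all? λ u → all? λ v → T? (tooth n u) →-dec (T? (tooth n v) →-dec
    (¬? (u ≟ v) →-dec within? L u v (hop (comb n) u v + K)))

  module _ {k} (k≤K : k ≤ K) (n : ℕ) where

    valid⇒good : ∀ lab → Valid (instanceOf k≤K n) lab → Good n (fromLabeling (comb n) lab)
    valid⇒good lab valid u v tu tv u≢v = finite (D-teeth tu tv)
      where
      D-teeth : T (tooth n u) → T (tooth n v) → D n u v ≡ [ hop (comb n) u v + K ]
      D-teeth tu tv with tooth n u | tooth n v
      ... | true | true = refl
      L : Lab (comb n)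
      L = fromLabeling (comb n) lab
      finite : D n u v ≡ [ hop (comb n) u v + K ] → Within L u v (hop (comb n) u v + K)
      finite eq with valid u v u≢v _ eq
      ... | P , _ , short with arr-duration L lab (label-fromLabeling (comb n) lab) u≢v P
      ...   | r , p = r , ≤-trans p (+-monoʳ-≤ r short)

    good⇒valid : ∀ L → Good n L → Valid (instanceOf k≤K n) (toLabeling L)
    good⇒valid L good u v u≢v d eq with fastest L u≢v
    ... | P , fast , short = P , fast , bound (good u v) eq
      where
      bound : (T (tooth n u) → T (tooth n v) → u ≢ v → Within L u v (hop (comb n) u v + K)) →
              D n u v ≡ [ d ] → TemporalPath.duration P ≤ d
      bound g eq with tooth n u | tooth n v
      bound g refl | true | true = short (g tt tt u≢v)

  -- Adding a tooth to a comb

  toothIn toothOut : ∀ {n} → Lab (comb n) → Fin Δ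
  -- In and out are seen from the spine: `a` leads from the tooth into the spine, `b` back out to
  -- the tooth.
  toothIn  (L ▷⟨ a ∣ b ⟩) = a
  toothOut (L ▷⟨ a ∣ b ⟩) = b

  -- The only longer wait is `suc K`, and `suc l + suc K` is `l + Δ`, which would make the labels
  -- congruent.
  gap-distinct : ∀ (l l′ : Fin Δ) → l ≢ l′ → gap (toℕ l) (toℕ l′) ≤ K
  gap-distinct l l′ l≢l′ = ≤-pred (≤∧≢⇒< (wait-≤ (toℕ l′) (suc (toℕ l))) λ full →
    l≢l′ (toℕ-injective (≈⇒≡ (toℕ<n l) (toℕ<n l′) (≈-trans (≈-sym (+-multiple (toℕ l) 1))
      (≈-trans (≡⇒≈ (trans (ring (toℕ l) K) (cong (suc (toℕ l) +_) (sym full))))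
        (gap-hits (toℕ l) (toℕ l′)))))))
    where
    ring : ∀ l K → l + 1 * suc (suc K) ≡ suc l + suc K
    ring = solve-∀

  -- The neighbouring labels modulo `Δ`, where `suc K` acts as -1.
  up down : Fin Δ → Fin Δ
  up   l = (toℕ l + 1) mod Δ
  down l = (toℕ l + suc K) mod Δ

  toℕ-mod : ∀ x → toℕ (x mod Δ) ≈ x
  toℕ-mod x = ≈-trans (≡⇒≈ (toℕ-fromℕ< (m%n<n x Δ))) (%-≈ x)

  suc-≈ : ∀ {x y} → x ≈ y → suc x ≈ suc y
  suc-≈ = ≈-+ (≈-refl {1})

  next-up : ∀ l r → next (toℕ (up l)) (next (toℕ l) r) ≡ suc (next (toℕ l) r)
  next-up l r = next-now _ (≈-trans (suc-≈ (wait-hits (toℕ l) r))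
    (≈-trans (≡⇒≈ (+-comm 1 (toℕ l))) (≈-sym (toℕ-mod _))))

  next-down : ∀ l {r} → suc r ≈ toℕ l → next (toℕ l) (next (toℕ (down l)) r) ≡ suc (suc r)
  next-down l {r} p = trans (cong (next (toℕ l)) (next-now _ q)) (next-now (toℕ l) p)
    where
    ring : ∀ r K → r + 1 * suc (suc K) ≡ suc r + suc K
    ring = solve-∀
    q : r ≈ toℕ (down l)
    q = ≈-trans (≈-sym (+-multiple r 1)) (≈-trans (≡⇒≈ (ring r K))
      (≈-trans (≈-+ p ≈-refl) (≈-sym (toℕ-mod _))))

  -- The new spine edge copies the labels a, b of the old tooth, which is harmless unless a ≡ b.
  extend : ∀ {n} → Lab (comb n) → Lab (comb (suc n))
  extend L = L ▷⟨ toothIn L ∣ toothOut L ⟩ ▷⟨ down (toothIn L) ∣ up (toothOut L) ⟩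

  -- Towards an older tooth, the new tooth sets out one step before the old one would, and idles no
  -- more; in the other direction it is reached one step later. Only the pair of old and new tooth
  -- has no model: both directions between them turn from `a` to `b`, which is affordable by
  -- `gap-distinct`.
  extend-good : ∀ n (L : Lab (comb n)) → toothIn L ≢ toothOut L → Good n L →
                Good (suc n) (extend L)
  extend-good n L@(M ▷⟨ a ∣ b ⟩) a≢b good = λ where
      zero          zero          _  _  u≢v → ⊥-elim (u≢v refl)
      zero          (suc (suc v)) _  tv _   → outgoing v tv
      (suc (suc u)) zero          tu _  _   → incoming u tu
      (suc (suc u)) (suc (suc v)) tu tv u≢v → good u v tu tv (u≢v ∘ cong (Fin.suc ∘ Fin.suc))
    where
    open ≤-Reasoning

    turn : ∀ l l′ r → l ≢ l′ → next (toℕ l′) (next (toℕ l) r) ≤ suc (next (toℕ l) r + K)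
    turn l l′ r l≢l′ = ≤-trans (≤-reflexive (next-next (toℕ l) (toℕ l′) r))
      (s≤s (+-monoʳ-≤ _ (gap-distinct l l′ l≢l′)))

    outgoing : ∀ v → T (tooth n v) →
               Within (extend L) zero (suc (suc v)) (hop (comb (suc n)) zero (suc (suc v)) + K)
    -- The departure is `a − 1`, taken one period later to stay in ℕ.
    outgoing zero _ = r , (begin
      next (toℕ b) (arr M zero zero (next (toℕ a) (next (toℕ (down a)) r)))
        ≡⟨ cong (next (toℕ b)) (arr-self M zero _) ⟩
      next (toℕ b) (next (toℕ a) (next (toℕ (down a)) r))
        ≤⟨ turn a b _ a≢b ⟩
      suc (next (toℕ a) (next (toℕ (down a)) r) + K)
        ≡⟨ cong (λ x → suc (x + K)) (next-down a (≈-trans (≡⇒≈ (ring (toℕ a) K)) (+-multiple _ 1))) ⟩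
      suc (suc (suc r) + K)
        ≡⟨ ring′ r K ⟩
      r + (3 + K)
        ≤⟨ +-monoʳ-≤ r (s≤s (s≤s (s≤s (m≤n+m K _)))) ⟩
      r + (3 + hop (spine n) zero zero + K) ∎)
      where
      r : ℕ
      r = toℕ a + suc K
      ring : ∀ a K → suc (a + suc K) ≡ a + 1 * suc (suc K)
      ring = solve-∀
      ring′ : ∀ r K → suc (suc (suc r) + K) ≡ r + (3 + K)
      ring′ = solve-∀
    outgoing (suc v) tv with good zero (suc v) tt tv (λ ())
    -- The old path uses label `a` at time `t`. The new one departs at `t − 1`, again one period
    -- later.
    ... | r₀ , p = t + suc K , (begin
      arr M zero v (next (toℕ a) (next (toℕ (down a)) (t + suc K)))
        ≡⟨ cong (arr M zero v) (next-down a
             (≈-trans (≡⇒≈ (ring t K)) (≈-trans (+-multiple t 1) (wait-hits (toℕ a) r₀)))) ⟩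
      arr M zero v (suc (suc (t + suc K)))
        ≡⟨ cong (arr M zero v) (cong suc (ring t K)) ⟩
      arr M zero v (suc t + 1 * Δ)
        ≡⟨ arr-shift M zero v (suc t) 1 ⟩
      arr M zero v (suc t) + 1 * Δ
        ≤⟨ +-monoˡ-≤ (1 * Δ) p ⟩
      r₀ + (suc h + K) + 1 * Δ
        ≤⟨ +-monoˡ-≤ (1 * Δ) (+-monoˡ-≤ (suc h + K) (m≤m+n r₀ _)) ⟩
      t + (suc h + K) + 1 * Δ
        ≡⟨ ring′ t h K ⟩
      t + suc K + (suc (suc h) + K) ∎)
      where
      t h : ℕ
      t = r₀ + wait (toℕ a) r₀
      h = hop (spine n) zero v
      ring : ∀ t K → suc (t + suc K) ≡ t + 1 * suc (suc K)
      ring = solve-∀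
      ring′ : ∀ t h K → t + (suc h + K) + 1 * suc (suc K) ≡ t + suc K + (suc (suc h) + K)
      ring′ = solve-∀

    incoming : ∀ u → T (tooth n u) →
               Within (extend L) (suc (suc u)) zero (hop (comb (suc n)) (suc (suc u)) zero + K)
    incoming zero _ = toℕ a , (begin
      next (toℕ (up b)) (next (toℕ b) (arr M zero zero (next (toℕ a) (toℕ a))))
        ≡⟨ cong (next (toℕ (up b)) ∘ next (toℕ b)) (arr-self M zero _) ⟩
      next (toℕ (up b)) (next (toℕ b) (next (toℕ a) (toℕ a)))
        ≡⟨ next-up b _ ⟩
      suc (next (toℕ b) (next (toℕ a) (toℕ a)))
        ≤⟨ s≤s (turn a b (toℕ a) a≢b) ⟩
      suc (suc (next (toℕ a) (toℕ a) + K))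
        ≡⟨ cong (λ x → suc (suc (x + K))) (next-now (toℕ a) ≈-refl) ⟩
      3 + (toℕ a + K)
        ≡⟨ ring (toℕ a) K ⟩
      toℕ a + (3 + K)
        ≤⟨ +-monoʳ-≤ (toℕ a) (s≤s (s≤s (s≤s (m≤n+m K _)))) ⟩
      toℕ a + (3 + hop (spine n) zero zero + K) ∎)
      where
      ring : ∀ a K → 3 + (a + K) ≡ a + (3 + K)
      ring = solve-∀
    incoming (suc u) tu with good (suc u) zero tu tt (λ ())
    ... | r , p = r , (begin
      next (toℕ (up b)) (next (toℕ b) (arr M u zero r))
        ≡⟨ next-up b _ ⟩
      suc (next (toℕ b) (arr M u zero r))
        ≤⟨ s≤s p ⟩
      suc (r + (suc (hop (spine n) u zero) + K))
        ≡⟨ sym (+-suc r _) ⟩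
      r + (suc (suc (hop (spine n) u zero)) + K) ∎)

  -- Idle times accumulated along the spine

  -- Inward C b W: some tooth loses at least W time steps on its way over an edge that leaves
  -- the last spine vertex with label b.  Outward is the same in the opposite direction.
  Inward Outward : ∀ {n} → Lab (comb n) → Fin Δ → ℕ → Set
  Inward {n} C b W = ∃ λ x → T (tooth n x) × ∀ r →
    r + (suc (hop (comb n) x (suc zero)) + W) ≤ next (toℕ b) (arr C x (suc zero) r)
  Outward {n} C a V = ∃ λ y → T (tooth n y) × ∀ r →
    r + wait (toℕ a) r + (suc (hop (comb n) (suc zero) y) + V) ≤ arr C (suc zero) y (next (toℕ a) r)

  inward-tooth : ∀ {n} (M : Lab (spine n)) p q b →
                 Inward {n} (M ▷⟨ p ∣ q ⟩) b (gap (toℕ p) (toℕ b))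
  inward-tooth {n} M p q b = zero , tt , λ r → begin
    r + (2 + hop (spine n) zero zero + g)  ≡⟨ cong (λ h → r + (2 + h + g)) (hop-self (spine n) zero) ⟩
    r + (2 + g)                            ≡⟨ ring r g ⟩
    suc (suc r + g)                        ≤⟨ s≤s (+-monoˡ-≤ g (next-> (toℕ p) r)) ⟩
    suc (next (toℕ p) r + g)               ≡⟨ sym (next-next (toℕ p) (toℕ b) r) ⟩
    next (toℕ b) (next (toℕ p) r)          ≡⟨ cong (next (toℕ b)) (sym (arr-self M zero _)) ⟩
    next (toℕ b) (arr M zero zero (next (toℕ p) r)) ∎
    where
    open ≤-Reasoning
    g : ℕ
    g = gap (toℕ p) (toℕ b)
    ring : ∀ r g → r + (2 + g) ≡ suc (suc r + g)
    ring = solve-∀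

  outward-tooth : ∀ {n} (M : Lab (spine n)) p q a →
                  Outward {n} (M ▷⟨ p ∣ q ⟩) a (gap (toℕ a) (toℕ q))
  outward-tooth {n} M p q a = zero , tt , λ r → begin
    r + wait (toℕ a) r + (2 + hop (spine n) zero zero + g)
      ≡⟨ cong (λ h → r + wait (toℕ a) r + (2 + h + g)) (hop-self (spine n) zero) ⟩
    r + wait (toℕ a) r + (2 + g)
      ≡⟨ ring (r + wait (toℕ a) r) g ⟩
    suc (next (toℕ a) r + g)
      ≡⟨ sym (next-next (toℕ a) (toℕ q) r) ⟩
    next (toℕ q) (next (toℕ a) r)
      ≡⟨ cong (next (toℕ q)) (sym (arr-self M zero _)) ⟩
    next (toℕ q) (arr M zero zero (next (toℕ a) r)) ∎
    where
    open ≤-Reasoning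
    g : ℕ
    g = gap (toℕ a) (toℕ q)
    ring : ∀ r g → r + (2 + g) ≡ suc (suc r + g)
    ring = solve-∀

  module _ {n} (C : Lab (comb n)) (a b p q : Fin Δ) where

    C⁺ : Lab (comb (suc n))
    C⁺ = C ▷⟨ a ∣ b ⟩ ▷⟨ p ∣ q ⟩

    inward-extend : ∀ {W} b′ → Inward C b W → Inward C⁺ b′ (W + gap (toℕ b) (toℕ b′))
    inward-extend {W} b′ (x , tx , late) = suc (suc x) , tx , λ r → begin
      r + (suc (suc h) + (W + g))      ≡⟨ ring r h W g ⟩
      suc (r + (suc h + W) + g)        ≤⟨ s≤s (+-monoˡ-≤ g (late r)) ⟩
      suc (next (toℕ b) (A r) + g)     ≡⟨ sym (next-next (toℕ b) (toℕ b′) (A r)) ⟩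
      next (toℕ b′) (next (toℕ b) (A r)) ∎
      where
      open ≤-Reasoning
      h g : ℕ
      h = hop (comb n) x (suc zero)
      g = gap (toℕ b) (toℕ b′)
      A : ℕ → ℕ
      A = arr C x (suc zero)
      ring : ∀ r h W g → r + (suc (suc h) + (W + g)) ≡ suc (r + (suc h + W) + g)
      ring = solve-∀

    outward-extend : ∀ {V} a′ → Outward C a V → Outward C⁺ a′ (V + gap (toℕ a′) (toℕ a))
    outward-extend {V} a′ (y , ty , late) = suc (suc y) , ty , λ r → begin
      r + wait (toℕ a′) r + (suc (suc h) + (V + g))
        ≡⟨ ring (r + wait (toℕ a′) r) h V g ⟩
      next (toℕ a′) r + g + (suc h + V)
        ≡⟨ cong (λ w → next (toℕ a′) r + w + (suc h + V)) (sym (wait-next (toℕ a′) (toℕ a) r)) ⟩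
      next (toℕ a′) r + wait (toℕ a) (next (toℕ a′) r) + (suc h + V)
        ≤⟨ late (next (toℕ a′) r) ⟩
      arr C (suc zero) y (next (toℕ a) (next (toℕ a′) r)) ∎
      where
      open ≤-Reasoning
      h g : ℕ
      h = hop (comb n) (suc zero) y
      g = gap (toℕ a′) (toℕ a)
      ring : ∀ r h V g → r + (suc (suc h) + (V + g)) ≡ suc r + g + (suc h + V)
      ring = solve-∀

    -- The path to the newest tooth turns from `b` to `q` after the loss `W`, and its idle time is
    -- at most `K` in total.
    inward-bound : ∀ {W} → Good (suc n) C⁺ → Inward C b W → W + gap (toℕ b) (toℕ q) ≤ K
    inward-bound {W} good (x , tx , late) with good (suc (suc x)) zero tx tt (λ ())
    ... | r , p = +-cancelˡ-≤ (r + suc (suc h)) _ _ (begin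
      r + suc (suc h) + (W + g)           ≡⟨ ring r h W g ⟩
      suc (r + (suc h + W) + g)           ≤⟨ s≤s (+-monoˡ-≤ g (late r)) ⟩
      suc (next (toℕ b) A + g)            ≡⟨ sym (next-next (toℕ b) (toℕ q) A) ⟩
      next (toℕ q) (next (toℕ b) A)       ≤⟨ p ⟩
      r + (suc (suc h) + K)               ≡⟨ sym (+-assoc r _ K) ⟩
      r + suc (suc h) + K                 ∎)
      where
      open ≤-Reasoning
      h g A : ℕ
      h = hop (comb n) x (suc zero)
      g = gap (toℕ b) (toℕ q)
      A = arr C x (suc zero) r
      ring : ∀ r h W g → r + suc (suc h) + (W + g) ≡ suc (r + (suc h + W) + g)
      ring = solve-∀

    outward-bound : ∀ {V} → Good (suc n) C⁺ → Outward C a V → V + gap (toℕ p) (toℕ a) ≤ K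
    outward-bound {V} good (y , ty , late) with good zero (suc (suc y)) tt ty (λ ())
    ... | r , short = +-cancelˡ-≤ (r + suc (suc h)) _ _ (begin
      r + suc (suc h) + (V + g)           ≡⟨ ring r h V g ⟩
      suc r + g + (suc h + V)             ≤⟨ +-monoˡ-≤ (suc h + V) (+-monoˡ-≤ g (next-> (toℕ p) r)) ⟩
      next (toℕ p) r + g + (suc h + V)
        ≡⟨ cong (λ w → next (toℕ p) r + w + (suc h + V)) (sym (wait-next (toℕ p) (toℕ a) r)) ⟩
      next (toℕ p) r + wait (toℕ a) (next (toℕ p) r) + (suc h + V)
        ≤⟨ late (next (toℕ p) r) ⟩
      arr C (suc zero) y (next (toℕ a) (next (toℕ p) r))
        ≤⟨ short ⟩
      r + (suc (suc h) + K)               ≡⟨ sym (+-assoc r _ K) ⟩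
      r + suc (suc h) + K                 ∎)
      where
      open ≤-Reasoning
      h g : ℕ
      h = hop (comb n) (suc zero) y
      g = gap (toℕ p) (toℕ a)
      ring : ∀ r h V g → r + suc (suc h) + (V + g) ≡ suc r + g + (suc h + V)
      ring = solve-∀

  -- Long combs are not realizable

  gap-zero : ∀ l l′ → gap l l′ ≤ 0 → suc l ≈ l′
  gap-zero l l′ p = ≈-trans
    (≡⇒≈ (trans (sym (+-identityʳ (suc l))) (cong (suc l +_) (sym (n≤0⇒n≡0 p)))))
    (gap-hits l l′)

  -- Let `W ≤ V`. Counting from `suc p`, one reaches `a` after `gap p a` steps, `b` after `W` more,
  -- and `b′` after one more. By the first bound this total is below `Δ`, so it equals `gap p b′`,
  -- which therefore exceeds `W`. If `V ≤ W`, the second bound shows in the same way that `gap a′ q`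
  -- is `suc (V + gap b q)` and exceeds `V`.
  stuck : ∀ {a b p q a′ b′ W V} → V + gap p a ≤ K → W + gap b q ≤ K →
          gap b b′ ≤ 0 → gap a′ a ≤ 0 → gap p b′ ≤ W → gap a′ q ≤ V →
          ¬ (a + W ⊓ V ≈ b)
  stuck {a} {b} {p} {q} {a′} {b′} {W} {V} out inn bb′ a′a g≤W h≤V eq with ≤-total W V
  ... | inj₁ W≤V = <⇒≱ (≤-reflexive (≈⇒≡ small (s≤s (wait-≤ b′ (suc p))) hit)) (≤-trans g≤W (m≤n+m W _))
    where
    small : suc (gap p a + W) < Δ
    small = s≤s (s≤s (≤-trans (≤-trans (+-monoʳ-≤ (gap p a) W≤V) (≤-reflexive (+-comm _ V))) out))
    ring : ∀ p g W → suc p + suc (g + W) ≡ suc (suc p + g + W)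
    ring = solve-∀
    hit : suc (gap p a + W) ≈ gap p b′
    hit = ≈-cancelˡ (suc p) (≈-trans (≡⇒≈ (ring p (gap p a) W))
      (≈-trans (suc-≈ (≈-trans (≈-+ (gap-hits p a) (≈-refl {W}))
        (≈-trans (≡⇒≈ (cong (a +_) (sym (m≤n⇒m⊓n≡m W≤V)))) eq)))
        (≈-trans (gap-zero b b′ bb′) (≈-sym (gap-hits p b′)))))
  ... | inj₂ V≤W = <⇒≱ (≤-reflexive (≈⇒≡ small (s≤s (wait-≤ q (suc a′))) hit)) (≤-trans h≤V (m≤m+n V _))
    where
    small : suc (V + gap b q) < Δ
    small = s≤s (s≤s (≤-trans (+-monoˡ-≤ (gap b q) V≤W) inn))
    ring : ∀ a V g → a + suc (V + g) ≡ suc (a + V) + g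
    ring = solve-∀
    hit : suc (V + gap b q) ≈ gap a′ q
    hit = ≈-cancelˡ a (≈-trans (≡⇒≈ (ring a V (gap b q)))
      (≈-trans (≈-+ (suc-≈ (≈-trans (≡⇒≈ (cong (a +_) (sym (m≥n⇒m⊓n≡n V≤W)))) eq)) (≈-refl {gap b q}))
        (≈-trans (gap-hits b q) (≈-trans (≈-sym (gap-hits a′ q)) (≈-+ (gap-zero a′ a a′a) ≈-refl)))))

  -- While W and V do not grow, a falls and b rises by one per tooth; k counts the teeth until
  -- a ≈ b − min(W, V), where `stuck` forces growth.
  record Progress n (C : Lab (comb n)) (a b : Fin Δ) : Set where
    field
      {W V k} : ℕ
      inward  : Inward C b W
      outward : Outward C a V
      phase   : toℕ a + W ⊓ V ≈ toℕ b + k * 2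
      budget  : n + suc k ≤ suc (W + V) * Δ

  Split : ∀ n → Lab (comb n) → Set
  Split n L = Good n L × toothIn L ≢ toothOut L

  limit : ℕ
  limit = suc (K + K) * Δ

  module _ (half : ℕ) (odd : Δ ≡ suc (half * 2)) where

    -- Here oddness enters: `suc half` is the inverse of 2 modulo `Δ`, and `k` is `suc half` times
    -- `x − y`, reduced.
    halve : ∀ x y → ∃ λ k → k < Δ × x ≈ y + k * 2
    halve x y = k , m%n<n (suc half * z) Δ , ≈-sym (≈-trans (≈-+ (≈-refl {y}) doubled)
      (≈-trans (≡⇒≈ (ring x y K)) (+-multiple x y)))
      where
      z k : ℕ
      z = x + y * suc K
      k = (suc half * z) % Δ
      ring : ∀ x y K → y + (x + y * suc K) ≡ x + y * suc (suc K)
      ring = solve-∀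
      ring₁ : ∀ k → k + k ≡ k * 2
      ring₁ = solve-∀
      ring₂ : ∀ h z → suc h * z + suc h * z ≡ z + z * suc (h * 2)
      ring₂ = solve-∀
      doubled : k * 2 ≈ z
      doubled = ≈-trans (≡⇒≈ (sym (ring₁ k)))
        (≈-trans (≈-+ (%-≈ (suc half * z)) (%-≈ (suc half * z)))
          (≈-trans (≡⇒≈ (trans (ring₂ half z) (cong (λ d → z + z * d) (sym odd))))
            (+-multiple z z)))

    -- The labels `a`, `b` belong to the next spine edge. Each new loss is the larger of two: the
    -- old loss plus the wait at the new spine vertex, and the turn at the newest tooth. If neither
    -- loss grows, `k` drops by one, and for `k = 0` this is impossible by `stuck`.
    progress : ∀ n (C : Lab (comb n)) a b → Good n C → Progress n C a b
    progress zero (M ▷⟨ p ∣ q ⟩) a b good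
      with halve (toℕ a + gap (toℕ p) (toℕ b) ⊓ gap (toℕ a) (toℕ q)) (toℕ b)
    ... | k , k<Δ , phase = record
      { inward = inward-tooth M p q b ; outward = outward-tooth M p q a ; phase = phase
      ; budget = ≤-trans k<Δ (m≤m+n Δ _) }
    progress (suc n) (C ▷⟨ a ∣ b ⟩ ▷⟨ p ∣ q ⟩) a′ b′ good
      with progress n C a b (λ u v tu tv u≢v → good (suc (suc u)) (suc (suc v)) tu tv
             (u≢v ∘ suc-injective ∘ suc-injective))
    ... | record { W = W ; V = V ; k = k ; inward = inward ; outward = outward
                 ; phase = phase ; budget = budget } = step (W + V <? W′ + V′)
      where
      i j g h W′ V′ : ℕ
      i = gap (toℕ b) (toℕ b′)
      j = gap (toℕ a′) (toℕ a)
      g = gap (toℕ p) (toℕ b′)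
      h = gap (toℕ a′) (toℕ q)
      W′ = (W + i) ⊔ g
      V′ = (V + j) ⊔ h

      inward′ : Inward (C ▷⟨ a ∣ b ⟩ ▷⟨ p ∣ q ⟩) b′ W′
      inward′ = ⊔-elim (Inward (C ▷⟨ a ∣ b ⟩ ▷⟨ p ∣ q ⟩) b′) (inward-extend C a b p q b′ inward)
                  (inward-tooth (C ▷⟨ a ∣ b ⟩) p q b′)
      outward′ : Outward (C ▷⟨ a ∣ b ⟩ ▷⟨ p ∣ q ⟩) a′ V′
      outward′ = ⊔-elim (Outward (C ▷⟨ a ∣ b ⟩ ▷⟨ p ∣ q ⟩) a′) (outward-extend C a b p q a′ outward)
                   (outward-tooth (C ▷⟨ a ∣ b ⟩) p q a′)

      W≤W′ : W ≤ W′
      W≤W′ = ≤-trans (m≤m+n W i) (m≤m⊔n (W + i) g)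
      V≤V′ : V ≤ V′
      V≤V′ = ≤-trans (m≤m+n V j) (m≤m⊔n (V + j) h)

      next-phase : W′ ≤ W → V′ ≤ V → Progress (suc n) _ a′ b′
      next-phase W′≤W V′≤V = continue k phase budget
        where
        i≤0 : i ≤ 0
        i≤0 = +-cancelˡ-≤ W i 0 (≤-trans (≤-trans (m≤m⊔n (W + i) g) W′≤W) (≤-reflexive (sym (+-identityʳ W))))
        j≤0 : j ≤ 0
        j≤0 = +-cancelˡ-≤ V j 0 (≤-trans (≤-trans (m≤m⊔n (V + j) h) V′≤V) (≤-reflexive (sym (+-identityʳ V))))
        W′≡W : W′ ≡ W
        W′≡W = ≤-antisym W′≤W W≤W′
        V′≡V : V′ ≡ V
        V′≡V = ≤-antisym V′≤V V≤V′
        ring : ∀ b k → b + (2 + k) ≡ suc (suc b + k)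
        ring = solve-∀
        continue : ∀ k → toℕ a + W ⊓ V ≈ toℕ b + k * 2 →
                   n + suc k ≤ suc (W + V) * Δ → Progress (suc n) _ a′ b′
        continue zero phase _ = ⊥-elim (stuck
          {a = toℕ a} {toℕ b} {toℕ p} {toℕ q} {toℕ a′} {toℕ b′} {W} {V}
          (outward-bound C a b p q good outward)
          (inward-bound C a b p q good inward) i≤0 j≤0
          (≤-trans (m≤n⊔m (W + i) g) W′≤W) (≤-trans (m≤n⊔m (V + j) h) V′≤V)
          (≈-trans phase (≡⇒≈ (+-identityʳ (toℕ b)))))
        continue (suc k) phase budget = record
          { inward = inward′ ; outward = outward′ ; k = k
          ; phase = ≈-trans (≡⇒≈ (cong (toℕ a′ +_) (cong₂ _⊓_ W′≡W V′≡V)))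
              (≈-cancelˡ 1 (≈-trans (≈-+ (gap-zero (toℕ a′) (toℕ a) j≤0) (≈-refl {W ⊓ V}))
                (≈-trans phase (≈-trans (≡⇒≈ (ring (toℕ b) (k * 2)))
                  (suc-≈ (≈-+ (gap-zero (toℕ b) (toℕ b′) i≤0) (≈-refl {k * 2})))))))
          ; budget = ≤-trans (≤-reflexive (sym (+-suc n (suc k))))
              (≤-trans budget (≤-reflexive (cong (λ x → suc x * Δ) (sym (cong₂ _+_ W′≡W V′≡V))))) }

      step : Dec (W + V < W′ + V′) → Progress (suc n) _ a′ b′
      step (no ≮) = next-phase
        (+-cancelʳ-≤ V W′ W (≤-trans (+-monoʳ-≤ W′ V≤V′) (≮⇒≥ ≮)))
        (+-cancelˡ-≤ W V′ V (≤-trans (+-monoˡ-≤ V′ W≤W′) (≮⇒≥ ≮)))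
      -- Growth of `W + V` adds at least one `Δ` to the budget, which pays for restarting with a
      -- fresh `k < Δ`.
      step (yes lt) with halve (toℕ a′ + W′ ⊓ V′) (toℕ b′)
      ... | k′ , k′<Δ , phase′ = record
        { inward = inward′ ; outward = outward′ ; phase = phase′
        ; budget = begin
            suc n + suc k′                   ≤⟨ +-mono-≤ (≤-trans (≤-trans (≤-reflexive (+-comm 1 n))
                                                  (+-monoʳ-≤ n (s≤s z≤n))) budget) k′<Δ ⟩
            suc (W + V) * Δ + Δ              ≡⟨ +-comm (suc (W + V) * Δ) Δ ⟩
            suc (suc (W + V)) * Δ            ≤⟨ *-monoˡ-≤ Δ (s≤s lt) ⟩
            suc (W′ + V′) * Δ                ∎ }
        where open ≤-Reasoning

    -- Once `W` and `V` are at most `K`, the budget keeps the index below `limit`. The comb is one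
    -- tooth longer than the one measured, because that tooth supplies the bounds on the losses.
    limit-bad : ∀ C → ¬ Good (suc limit) C
    limit-bad (C ▷⟨ a ∣ b ⟩ ▷⟨ p ∣ q ⟩) good
      with progress limit C a b (λ u v tu tv u≢v → good (suc (suc u)) (suc (suc v)) tu tv
             (u≢v ∘ suc-injective ∘ suc-injective))
    ... | record { W = W ; V = V ; k = k ; inward = inward ; outward = outward ; budget = budget } =
      <⇒≱ (≤-trans (≤-reflexive (+-comm 1 limit)) (+-monoʳ-≤ limit (s≤s (z≤n {k}))))
        (≤-trans budget (*-monoˡ-≤ Δ (s≤s (+-mono-≤
          (m+n≤o⇒m≤o W (inward-bound C a b p q good inward))
          (m+n≤o⇒m≤o V (outward-bound C a b p q good outward))))))

    -- Starting from the comb with one tooth, where `Good` is vacuous, extend while some good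
    -- labeling separates the two labels of the last tooth. By `limit-bad` this stops before index
    -- `suc limit`.
    rigid-comb : ∃ λ n → ∃ (Good n) × ¬ ∃ (Split n)
    rigid-comb = search (suc limit) 0 (+-identityʳ _) (∅ ▷⟨ zero ∣ zero ⟩ , λ
      { zero zero _ _ u≢v → ⊥-elim (u≢v refl) ; zero (suc zero) _ () _ ; (suc zero) _ () _ _ })
      where
      search : ∀ fuel n → fuel + n ≡ suc limit → ∃ (Good n) → ∃ λ n → ∃ (Good n) × ¬ ∃ (Split n)
      search zero n refl (L , good) = ⊥-elim (limit-bad L good)
      search (suc fuel) n eq good
        with anyLab? (comb n) (λ L → good? n L ×-dec ¬? (toothIn L ≟ toothOut L))
      ... | no rigid = n , good , rigid
      ... | yes (L , goodL , a≢b) = search fuel (suc n) (trans (+-suc fuel n) eq)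
              (extend L , extend-good n L a≢b goodL)

-- The gadget for an odd period

lemma17 : (Δ k : ℕ) → 1 ≤ k → k + 2 ≤ Δ → ¬ (2 ∣ Δ) →
    Σ (DiTTR Δ k) λ I →
    Realizable I ×
    (Σ (DiTTR.Vertex I) λ v₁ → Σ (DiTTR.Vertex I) λ v₂ →
    Σ (DiTTR.Edge I v₁ v₂) λ e → EnforcesEqual I e)
lemma17 zero k _ k+2≤Δ _ = contradiction (≤-trans (m≤n+m 2 k) k+2≤Δ) λ ()
lemma17 (suc zero) k _ k+2≤Δ _ = contradiction (≤-trans (m≤n+m 2 k) k+2≤Δ) λ { (s≤s ()) }
lemma17 Δ@(suc (suc K)) k _ k+2≤Δ 2∤Δ = conclude (rigid-comb (Δ / 2) odd)
  where
  open Gadget K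
  open Periodic (suc K) using (toLabeling; fromLabeling; label-fromLabeling)

  k≤K : k ≤ K
  k≤K = +-cancelʳ-≤ 2 k K (≤-trans k+2≤Δ (≤-reflexive (+-comm 2 K)))

  odd : Δ ≡ suc (Δ / 2 * 2)
  odd with Δ % 2 in eq | m%n<n Δ 2 | m≡m%n+[m/n]*n Δ 2
  ... | zero        | _                 | _ = contradiction (m%n≡0⇒n∣m Δ 2 eq) 2∤Δ
  ... | suc zero    | _                 | p = p
  ... | suc (suc _) | s≤s (s≤s ())      | _

  conclude : (∃ λ n → ∃ (Good n) × ¬ ∃ (Split n)) → _
  conclude (n , (L , good) , rigid) =
    instanceOf k≤K n , (toLabeling L , good⇒valid k≤K n L good) ,
    -- The enforced edge joins the last tooth to its spine vertex.
    zero , suc zero , tt , λ lab valid →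
      -- A valid labeling with different labels there would be one of those that `rigid` excludes.
      decidable-stable (lab zero (suc zero) tt ≟ lab (suc zero) zero tt) λ a≢b →
        rigid (fromLabeling (comb n) lab , valid⇒good k≤K n lab valid , a≢b)
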